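{- Let $\xi=(L^\xi,\Delta_0^\xi,B^\xi,d,G)$ be an EA-stable generic configuration, and let $\alpha=B^\xi+\mathrm{SelfCons}^1(B^\xi,d)$ be $\xi$'s corresponding Level(1) self-justifying axiom system. Then there exists a translation methodology $T$ (mapping each $\Pi_1^\xi$ sentence $\Psi$ to a $\Pi_1^\xi$ sentence $\Psi^T$ equivalent to $\Psi$ in the Standard-M model) such that $\alpha$ can prove $$\forall p\ [\ \mathrm{Prf}_{\alpha,d}(\lceil\Psi\rceil,p)\Rightarrow\Psi^T\ ]$$ for all $\Pi_1^\xi$ sentences $\Psi$ simultaneously.
   Context: **Generic configurations.** Standard-M is the standard model of the natural numbers. $\mathrm{Log}$ is the base-2 logarithm. A generic configuration $\xi$ is a 5-tuple $(L^\xi,\Delta_0^\xi,B^\xi,d,G)$ where: (1) $L^\xi$ is a language with symbols for $0,1,2,=,\le$ and $\mathrm{Maximum}(x,y)$, and enough function and constant symbols that every integer $k$ is the value of some term $T_k$. (2) $\Delta_0^\xi$ is a fixed class of fully bounded $L^\xi$-formulas (all quantifiers have the form $\exists v\le T$ or $\forall v\le T$ with $T$ a term), closed under negation, and rich enough to contain two formulas $\mathrm{Add}(x,y,z)$ and $\mathrm{Mult}(x,y,z)$ defining the graphs of addition and multiplication. Every $\Delta_0^\xi$ formula is both $\Pi_0^\xi$ and $\Sigma_0^\xi$; for $n\ge1$ a formula is $\Pi_n^\xi$ (resp. $\Sigma_n^\xi$) iff it can be written $\forall v_1\cdots\forall v_k\,\Phi$ with $\Phi\in\Sigma_{n-1}^\xi$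 (resp. $\exists v_1\cdots\exists v_k\,\Phi$ with $\Phi\in\Pi_{n-1}^\xi$); $\Delta_0^\xi$ sentences count as both $\Pi_1^\xi$ and $\Sigma_1^\xi$. (3) $B^\xi$ (the base axiom system) is an axiom system whose axioms are true in Standard-M and which is $\Sigma_1^\xi$-complete: it proves every true $\Sigma_1^\xi$ sentence and refutes every false $\Pi_1^\xi$ sentence. (4) $d$ is a deduction method, conventional enough to satisfy the indirect-implication property associated with Gödel's Completeness Theorem: whether or not modus ponens is built in, whenever it can prove $X$, $Y$ and $(X\wedge Y)\to Z$, it can prove $Z$ (possibly by a much longer proof). (5) $G$ is a method for encoding the Gödel numbers of proofs. Proofs are identified with their Gödel numbers $p$. **Goodness.** $E(N)$ is a term of value $2^N$. For a prenex sentence $\Upsilon$, $\mathrm{Scope}_E(\Upsilon,N)$ is obtained from $\Upsilon$ by replacing each unbounded $\forall v$ by $\forall v<E(N)$ and each unbounded $\exists v$ by $\exists v<E(N)$, leaving the bounded quantifiers of the $\Delta_0^\xi$ part unchanged. A $\Pi_1^\xi$ or $\Sigma_1^\xi$ sentence $\Upsilon$ is $\mathrm{Good}(N)$ when $\mathrm{Scope}_E(\Upsilon,N)$ is true in Standard-M ($\mathrm{Good}(\infty)$ means true in Standard-M). For a set $\theta$ of $\Pi_1^\xi$ sentences, $\sharp(\theta)$ is the largest integer $J$ such that every sentence of $\theta$ is $\mathrm{Good}(J)$, and $\sharp(\theta)=\infty$ if this holds for all $J$. **Stability.** $\mathrm{RE\text{ - }Class}(\xi)$ is the set of all recursively enumerable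 sets $\theta$ of $\Pi_1^\xi$ sentences (true or not). - $\xi$ is A-stable iff for every $\theta\in\mathrm{RE\text{ - }Class}(\xi)$: if $\Upsilon$ is a $\Pi_1^\xi$ theorem of $\theta\cup B^\xi$ via a proof $p$ with $\mathrm{Log}(p)\le\sharp(\theta)+1$, then $\Upsilon$ is $\mathrm{Good}\{\tfrac12\sharp(\theta)\}$. - $\xi$ is E-stable iff for every $\theta\in\mathrm{RE\text{ - }Class}(\xi)$: if $\Upsilon$ is a $\Sigma_1^\xi$ theorem of $\theta\cup B^\xi$ via a proof $p$ with $\mathrm{Log}(p)\le\sharp(\theta)+1$, then $\Upsilon$ is $\mathrm{Good}\{\tfrac12\lfloor\mathrm{Log}(p)\rfloor-1\}$. - $\xi$ is EA-stable iff it is both E-stable and A-stable. **Self-consistency axioms.** An axiom system $\alpha\supseteq B^\xi$ is Level$(k^\xi)$ consistent when there are no proofs from $\alpha$ via $d$ of both a $\Pi_k^\xi$ sentence and the $\Sigma_k^\xi$ sentence that is its negation. For $\beta\supseteq B^\xi$, $\mathrm{SelfCons}^k(\beta,d)$ is a self-referencing $\Pi_1^\xi$ sentence asserting the Level$(k^\xi)$ consistency of $\beta+\mathrm{SelfCons}^k(\beta,d)$. Explicitly, use $\Delta_0^\xi$ formulas: $\mathrm{Neg}^k(x,y)$: $x$ is the Gödel number of a $\Pi_k^\xi$ sentence and $y$ that of the $\Sigma_k^\xi$ sentence which is its negation; $\mathrm{SubstPrf}^d_\beta(g,t,p)$: there is $h$ such that $h$ encodes the sentence obtained from the formula with code $g$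 by replacing its free variables by the numeral $\bar g$, and $p$ is a proof of $t$ via $d$ from $\beta$ together with the sentence coded by $h$. Let $\Gamma^k(g)$ be $\forall x\forall y\forall p\forall q\ \neg\{\mathrm{Neg}^k(x,y)\wedge\mathrm{SubstPrf}^d_\beta(g,x,p)\wedge\mathrm{SubstPrf}^d_\beta(g,y,q)\}$ and $n$ its Gödel number; then $\mathrm{SelfCons}^k(\beta,d)$ is $\Gamma^k(\bar n)$. **Translations.** A translation methodology $T$ is an algorithm that maps each $\Pi_1^\xi$ sentence $\Psi$ onto a sentence $\Psi^T$ that is equivalent to $\Psi$ in Standard-M and which is also written in $\Pi_1^\xi$ format. $\lceil\Psi\rceil$ is the Gödel number of $\Psi$, and $\mathrm{Prf}_{\alpha,d}(t,p)$ is the formula stating that $p$ is a proof of $t$ from $\alpha$ using $d$. -}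

module Defs where

open import Data.Fin using (Fin; zero; suc)
open import Data.Fin.Patterns using (0F; 1F; 2F; 3F; 4F)
open import Data.Integer using (ℤ; +_; -[1+_]; _⊖_)
open import Data.Nat using (ℕ; zero; suc; _+_; _*_; _^_; _⊔_; _≤_; _<_; _≤?_)
open import Data.Nat.Logarithm using (⌊log₂_⌋)
open import Data.Product using (Σ; ∃; ∃-syntax; _×_; _,_; proj₁)
open import Data.Sum using (_⊎_)
open import Data.Unit using (⊤)
open import Data.Vec using (Vec; []; _∷_; lookup; map; replicate; tabulate)
open import Data.Vec.Relation.Binary.Pointwise.Inductive using (Pointwise)
open import Function using (_∘_; _⇔_)
open import Level using (0ℓ)
open import Relation.Binary.PropositionalEquality using (_≡_)
open import Relation.Nullary using (¬_; yes; no)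
open import Relation.Nullary.Construct.Add.Supremum using (_⁺; [_]; ⊤⁺)
open import Relation.Unary using (Pred; _⊆_; _∪_; ｛_｝)

data Rec : ℕ → Set where
  zeroᴿ : ∀ {n} → Rec n
  sucᴿ  : Rec 1
  proj  : ∀ {n} → Fin n → Rec n
  comp  : ∀ {m n} → Rec m → Vec (Rec n) m → Rec n
  prec  : ∀ {n} → Rec n → Rec (suc (suc n)) → Rec (suc n)
  μ     : ∀ {n} → Rec (suc n) → Rec n

infix 4 _⟨_⟩⇓_

data _⟨_⟩⇓_ : ∀ {n} → Rec n → Vec ℕ n → ℕ → Set where
  ⇓zero     : ∀ {n} {xs : Vec ℕ n} → zeroᴿ ⟨ xs ⟩⇓ 0
  ⇓suc      : ∀ {x} → sucᴿ ⟨ x ∷ [] ⟩⇓ suc x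
  ⇓proj     : ∀ {n} {xs : Vec ℕ n} {i} → proj i ⟨ xs ⟩⇓ lookup xs i
  ⇓comp     : ∀ {m n} {f : Rec m} {gs : Vec (Rec n) m} {xs ys z} →
              Pointwise (λ g y → g ⟨ xs ⟩⇓ y) gs ys → f ⟨ ys ⟩⇓ z →
              comp f gs ⟨ xs ⟩⇓ z
  ⇓prec-zero : ∀ {n} {f : Rec n} {g xs y} →
              f ⟨ xs ⟩⇓ y → prec f g ⟨ 0 ∷ xs ⟩⇓ y
  ⇓prec-suc : ∀ {n} {f : Rec n} {g k xs y z} →
              prec f g ⟨ k ∷ xs ⟩⇓ y → g ⟨ k ∷ y ∷ xs ⟩⇓ z →
              prec f g ⟨ suc k ∷ xs ⟩⇓ z
  ⇓μ        : ∀ {n} {f : Rec (suc n)} {xs y} →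
              f ⟨ y ∷ xs ⟩⇓ 0 →
              (∀ z → z < y → ∃[ k ] f ⟨ z ∷ xs ⟩⇓ suc k) →
              μ f ⟨ xs ⟩⇓ y

RecursivelyEnumerable : Pred ℕ 0ℓ → Set
RecursivelyEnumerable S = ∃[ f ] (∀ x → S x ⇔ (∃[ n ] f ⟨ n ∷ [] ⟩⇓ x))

record Signature : Set₁ where
  field
    Fun                 : ℕ → Set
    zeroˢ oneˢ twoˢ     : Fun 0
    maximumˢ            : Fun 2

module Syntax (S : Signature) where
  open Signature S

  data Term (n : ℕ) : Set where
    var : Fin n → Term n
    fun : ∀ {k} → Fun k → Vec (Term n) k → Term n

  infix  9 _≈'_ _≤'_
  infixr 8 ¬'_
  infixr 7 _∧'_
  infixr 6 _∨'_
  infixr 5 _⇒'_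
  infix  10 _⟪_⟫ᵗ _⟪_⟫

  -- Variables are de Bruijn indices.  In ∀≤ t φ and ∃≤ t φ the bound t does
  -- not contain the quantified variable.  Bounded quantifiers are primitive,
  -- so that a formula determines which of its quantifiers are unbounded.
  data Formula (n : ℕ) : Set where
    _≈'_ _≤'_           : Term n → Term n → Formula n
    ¬'_                 : Formula n → Formula n
    _∧'_ _∨'_ _⇒'_      : Formula n → Formula n → Formula n
    ∀' ∃'               : Formula (suc n) → Formula n
    ∀≤ ∃≤               : Term n → Formula (suc n) → Formula n

  Sentence : Set
  Sentence = Formula 0

  _⟪_⟫ᵗ  : ∀ {m n} → Term n → Vec (Term m) n → Term m
  _⟪_⟫ᵗˢ : ∀ {m n k} → Vec (Term n) k → Vec (Term m) n → Vec (Term m) k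
  var i    ⟪ σ ⟫ᵗ = lookup σ i
  fun f ts ⟪ σ ⟫ᵗ = fun f (ts ⟪ σ ⟫ᵗˢ)
  []       ⟪ σ ⟫ᵗˢ = []
  (t ∷ ts) ⟪ σ ⟫ᵗˢ = t ⟪ σ ⟫ᵗ ∷ ts ⟪ σ ⟫ᵗˢ

  weakenᵗ : ∀ {n} → Term n → Term (suc n)
  weakenᵗ t = t ⟪ tabulate (var ∘ suc) ⟫ᵗ

  lift : ∀ {m n} → Vec (Term m) n → Vec (Term (suc m)) (suc n)
  lift σ = var zero ∷ map weakenᵗ σ

  _⟪_⟫ : ∀ {m n} → Formula n → Vec (Term m) n → Formula m
  (s ≈' t) ⟪ σ ⟫ = s ⟪ σ ⟫ᵗ ≈' t ⟪ σ ⟫ᵗ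
  (s ≤' t) ⟪ σ ⟫ = s ⟪ σ ⟫ᵗ ≤' t ⟪ σ ⟫ᵗ
  (¬' φ)   ⟪ σ ⟫ = ¬' (φ ⟪ σ ⟫)
  (φ ∧' ψ) ⟪ σ ⟫ = φ ⟪ σ ⟫ ∧' ψ ⟪ σ ⟫
  (φ ∨' ψ) ⟪ σ ⟫ = φ ⟪ σ ⟫ ∨' ψ ⟪ σ ⟫
  (φ ⇒' ψ) ⟪ σ ⟫ = φ ⟪ σ ⟫ ⇒' ψ ⟪ σ ⟫
  (∀' φ)   ⟪ σ ⟫ = ∀' (φ ⟪ lift σ ⟫)
  (∃' φ)   ⟪ σ ⟫ = ∃' (φ ⟪ lift σ ⟫)
  (∀≤ t φ) ⟪ σ ⟫ = ∀≤ (t ⟪ σ ⟫ᵗ) (φ ⟪ lift σ ⟫)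
  (∃≤ t φ) ⟪ σ ⟫ = ∃≤ (t ⟪ σ ⟫ᵗ) (φ ⟪ lift σ ⟫)

  data Bounded {n : ℕ} : Formula n → Set where
    _≈'_ : ∀ s t → Bounded (s ≈' t)
    _≤'_ : ∀ s t → Bounded (s ≤' t)
    ¬'_  : ∀ {φ} → Bounded φ → Bounded (¬' φ)
    _∧'_ : ∀ {φ ψ} → Bounded φ → Bounded ψ → Bounded (φ ∧' ψ)
    _∨'_ : ∀ {φ ψ} → Bounded φ → Bounded ψ → Bounded (φ ∨' ψ)
    _⇒'_ : ∀ {φ ψ} → Bounded φ → Bounded ψ → Bounded (φ ⇒' ψ)
    ∀≤   : ∀ t {φ} → Bounded φ → Bounded (∀≤ t φ)
    ∃≤   : ∀ t {φ} → Bounded φ → Bounded (∃≤ t φ)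

  -- The negation of a prenex formula, again written in prenex form: the
  -- unbounded prefix is dualised and the matrix is negated.
  dual : ∀ {n} → Formula n → Formula n
  dual (∀' φ) = ∃' (dual φ)
  dual (∃' φ) = ∀' (dual φ)
  dual φ      = ¬' φ

  ∀< ∃< : ∀ {n} → Term n → Formula (suc n) → Formula n
  ∀< t φ = ∀≤ t (¬' (weakenᵗ t ≤' var zero) ⇒' φ)
  ∃< t φ = ∃≤ t (¬' (weakenᵗ t ≤' var zero) ∧' φ)

  -- Bounds the unbounded prefix of a prenex formula by the term t.
  Scope : ∀ {n} → Term n → Formula n → Formula n
  Scope t (∀' φ) = ∀< t (Scope (weakenᵗ t) φ)
  Scope t (∃' φ) = ∃< t (Scope (weakenᵗ t) φ)
  Scope t φ      = φ

  record Structure : Set₁ where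
    infix 4 _≤ᴹ_
    field
      Carrier : Set
      ⟦_⟧     : ∀ {k} → Fun k → Vec Carrier k → Carrier
      _≤ᴹ_    : Carrier → Carrier → Set

    eval  : ∀ {n} → Term n → Vec Carrier n → Carrier
    evals : ∀ {n k} → Vec (Term n) k → Vec Carrier n → Vec Carrier k
    eval (var i)    ρ = lookup ρ i
    eval (fun f ts) ρ = ⟦ f ⟧ (evals ts ρ)
    evals []       ρ = []
    evals (t ∷ ts) ρ = eval t ρ ∷ evals ts ρ

    Sat : ∀ {n} → Formula n → Vec Carrier n → Set
    Sat (s ≈' t) ρ = eval s ρ ≡ eval t ρ
    Sat (s ≤' t) ρ = eval s ρ ≤ᴹ eval t ρ
    Sat (¬' φ)   ρ = ¬ Sat φ ρ
    Sat (φ ∧' ψ) ρ = Sat φ ρ × Sat ψ ρ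
    Sat (φ ∨' ψ) ρ = Sat φ ρ ⊎ Sat ψ ρ
    Sat (φ ⇒' ψ) ρ = Sat φ ρ → Sat ψ ρ
    Sat (∀' φ)   ρ = ∀ a → Sat φ (a ∷ ρ)
    Sat (∃' φ)   ρ = ∃[ a ] Sat φ (a ∷ ρ)
    Sat (∀≤ t φ) ρ = ∀ a → a ≤ᴹ eval t ρ → Sat φ (a ∷ ρ)
    Sat (∃≤ t φ) ρ = ∃[ a ] a ≤ᴹ eval t ρ × Sat φ (a ∷ ρ)

  Axioms : Set₁
  Axioms = Pred Sentence 0ℓ

  infix 4 _⊨_

  _⊨_ : Axioms → Sentence → Set₁
  A ⊨ φ = (M : Structure) → let open Structure M in
          (∀ {χ} → A χ → Sat χ []) → Sat φ []

  -- `complete` is the content of Gödel's Completeness Theorem.  It does not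
  -- yield `indirect`: modus ponens need not be a rule, and soundness is not
  -- assumed.  Structures are not required to have decidable satisfaction;
  -- classically this makes no difference, and constructively it only weakens
  -- what `complete` asks of the method.
  record DeductionMethod : Set₁ where
    field
      Proof  : Set
      Proves : Axioms → Proof → Sentence → Set

    Provable : Axioms → Sentence → Set
    Provable A φ = ∃[ π ] Proves A π φ

    field
      monotone : ∀ {A A′ π φ} → A ⊆ A′ → Proves A π φ → Proves A′ π φ
      complete : ∀ {A φ} → A ⊨ φ → Provable A φ
      indirect : ∀ {A X Y Z} → Provable A X → Provable A Y →
                 Provable A (X ∧' Y ⇒' Z) → Provable A Z

record Language : Set₁ where
  field signature : Signature
  open Signature signature public
  open Syntax signature public
  field standard : ∀ {k} → Fun k → Vec ℕ k → ℕ

  Standard-M : Structure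
  Standard-M = record { Carrier = ℕ ; ⟦_⟧ = standard ; _≤ᴹ_ = _≤_ }

  open Structure Standard-M public using () renaming (eval to evalℕ; Sat to Satℕ)

  True : Sentence → Set
  True φ = Satℕ φ []

  field
    zero-value    : standard zeroˢ [] ≡ 0
    one-value     : standard oneˢ [] ≡ 1
    two-value     : standard twoˢ [] ≡ 2
    maximum-value : ∀ x y → standard maximumˢ (x ∷ y ∷ []) ≡ x ⊔ y
    numeral       : ℕ → Term 0
    numeral-value : ∀ k → evalℕ (numeral k) [] ≡ k

module _ (L : Language) where
  open Language L

  record Δ₀-Class : Set₁ where
    field
      Δ₀         : ∀ {n} → Formula n → Set
      bounded    : ∀ {n} {φ : Formula n} → Δ₀ φ → Bounded φ
      closed-¬   : ∀ {n} {φ : Formula n} → Δ₀ φ → Δ₀ (¬' φ)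
      -- Needed for the matrix of a self-referencing sentence, a conjunction of
      -- instances of Δ₀ formulas, to be Δ₀ again.
      closed-∧   : ∀ {n} {φ ψ : Formula n} → Δ₀ φ → Δ₀ ψ → Δ₀ (φ ∧' ψ)
      closed-sub : ∀ {m n} {φ : Formula n} (σ : Vec (Term m) n) →
                   Δ₀ φ → Δ₀ (φ ⟪ σ ⟫)
      Add Mult   : Formula 3
      Add-Δ₀     : Δ₀ Add
      Mult-Δ₀    : Δ₀ Mult
      Add-graph  : ∀ x y z → Satℕ Add (x ∷ y ∷ z ∷ []) ⇔ x + y ≡ z
      Mult-graph : ∀ x y z → Satℕ Mult (x ∷ y ∷ z ∷ []) ⇔ x * y ≡ z

    data IsΠ : ℕ → ∀ {n} → Formula n → Set
    data IsΣ : ℕ → ∀ {n} → Formula n → Set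

    data IsΠ where
      Δ₀→Π : ∀ {n} {φ : Formula n} → Δ₀ φ → IsΠ 0 φ
      Σ→Π  : ∀ {k n} {φ : Formula n} → IsΣ k φ → IsΠ (suc k) φ
      ∀'   : ∀ {k n} {φ : Formula (suc n)} →
             IsΠ (suc k) φ → IsΠ (suc k) (∀' φ)

    data IsΣ where
      Δ₀→Σ : ∀ {n} {φ : Formula n} → Δ₀ φ → IsΣ 0 φ
      Π→Σ  : ∀ {k n} {φ : Formula n} → IsΠ k φ → IsΣ (suc k) φ
      ∃'   : ∀ {k n} {φ : Formula (suc n)} →
             IsΣ (suc k) φ → IsΣ (suc k) (∃' φ)

  record GödelNumbering (d : DeductionMethod) : Set where
    open DeductionMethod d
    field
      ⌜_⌝           : ∀ {n} → Formula n → ℕ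
      ⌜⌝-injective  : ∀ {m n} {φ : Formula m} {ψ : Formula n} →
                      ⌜ φ ⌝ ≡ ⌜ ψ ⌝ → _≡_ {A = Σ ℕ Formula} (m , φ) (n , ψ)
      -- Codes of proofs are positive, so that their logarithm is defined.
      ⌜_⌝ᵖ          : Proof → ℕ
      ⌜⌝ᵖ-injective : ∀ {π π′} → ⌜ π ⌝ᵖ ≡ ⌜ π′ ⌝ᵖ → π ≡ π′
      ⌜⌝ᵖ-positive  : ∀ π → 0 < ⌜ π ⌝ᵖ
      -- Effectiveness of the numbering, without which "algorithm on sentences"
      -- would depend on an arbitrary assignment of codes.
      dual-recursive : ∃[ f ] ((φ : Sentence) → f ⟨ ⌜ φ ⌝ ∷ [] ⟩⇓ ⌜ dual φ ⌝)
      inst-recursive : ∃[ f ] ((φ : Formula 1) (m : ℕ) →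
                       f ⟨ ⌜ φ ⌝ ∷ m ∷ [] ⟩⇓ ⌜ φ ⟪ numeral m ∷ [] ⟫ ⌝)

    IsProof : Axioms → ℕ → Sentence → Set
    IsProof A p φ = ∃[ π ] ⌜ π ⌝ᵖ ≡ p × Proves A π φ

record GenericConfiguration : Set₁ where
  field
    L : Language
    Δ : Δ₀-Class L
  open Language L public
  open Δ₀-Class Δ public

  field
    B : Axioms
    d : DeductionMethod
    G : GödelNumbering L d
  open DeductionMethod d public
  open GödelNumbering G public

  field
    B-true     : ∀ {φ} → B φ → True φ
    B-proves   : ∀ {φ} → IsΣ 1 φ → True φ → Provable B φ
    B-refutes  : ∀ {φ} → IsΠ 1 φ → ¬ True φ → Provable B (dual φ)

-- The least k with m ≤ k * k.
⌈√_⌉ : ℕ → ℕ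
⌈√ zero ⌉ = 0
⌈√ suc m ⌉ with suc m ≤? ⌈√ m ⌉ * ⌈√ m ⌉
... | yes _ = ⌈√ m ⌉
... | no  _ = suc ⌈√ m ⌉

-- The ceiling of 2^(n/2), so that v < ⌈2^½ n ⌉ iff v < 2^(n/2) for v in ℕ.
⌈2^½_⌉ : ℤ → ℕ
⌈2^½ + n ⌉      = ⌈√ 2 ^ n ⌉
⌈2^½ -[1+ n ] ⌉ = 1

module _ (ξ : GenericConfiguration) where
  open GenericConfiguration ξ

  -- Good½ n is Good(n/2): the bounds ½♯(θ) and ½⌊Log p⌋ - 1 are half-integers.
  Good½ : ℤ → Sentence → Set
  Good½ n Υ = True (Scope (numeral ⌈2^½ n ⌉) Υ)

  Good : ℕ → Sentence → Set
  Good N = Good½ (+ (2 * N))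

  AllGood : Pred Sentence 0ℓ → ℕ → Set
  AllGood θ J = ∀ {φ} → θ φ → Good J φ

  -- The graph of ♯, with ⊤⁺ as ∞.  If some sentence of θ fails already at
  -- Good(0), there is no largest J and θ has no ♯.
  _♯≡_ : Pred Sentence 0ℓ → ℕ ⁺ → Set
  θ ♯≡ [ J ] = AllGood θ J × (∀ J′ → AllGood θ J′ → J′ ≤ J)
  θ ♯≡ ⊤⁺    = ∀ J → AllGood θ J

  Good-½♯ : ℕ ⁺ → Sentence → Set
  Good-½♯ [ J ] = Good½ (+ J)
  Good-½♯ ⊤⁺    = True

  -- Log(p) ≤ s + 1, for the real-valued base-2 logarithm.
  Log_≤_+1 : ℕ → ℕ ⁺ → Set
  Log p ≤ [ J ] +1 = p ≤ 2 ^ suc J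
  Log p ≤ ⊤⁺    +1 = ⊤

  RE-Class : Pred (Pred Sentence 0ℓ) 0ℓ
  RE-Class θ = (∀ {φ} → θ φ → IsΠ 1 φ) ×
               RecursivelyEnumerable (λ x → ∃[ φ ] θ φ × ⌜ φ ⌝ ≡ x)

  A-Stable : Set₁
  A-Stable = ∀ {θ} → RE-Class θ → ∀ {s} → θ ♯≡ s →
             ∀ {Υ p} → IsΠ 1 Υ → IsProof (θ ∪ B) p Υ → Log p ≤ s +1 →
             Good-½♯ s Υ

  E-Stable : Set₁
  E-Stable = ∀ {θ} → RE-Class θ → ∀ {s} → θ ♯≡ s →
             ∀ {Υ p} → IsΣ 1 Υ → IsProof (θ ∪ B) p Υ → Log p ≤ s +1 →
             Good½ (⌊log₂ p ⌋ ⊖ 2) Υ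

  EA-Stable : Set₁
  EA-Stable = E-Stable × A-Stable

  -- SubstPrf has free variables g, t, p in this order.
  record SelfReference (k : ℕ) (β : Axioms) : Set where
    field
      Neg         : Formula 2
      Neg-Δ₀      : Δ₀ Neg
      Neg-spec    : ∀ x y → Satℕ Neg (x ∷ y ∷ []) ⇔
                    (Σ Sentence λ Ψ → IsΠ k Ψ × ⌜ Ψ ⌝ ≡ x × ⌜ dual Ψ ⌝ ≡ y)
      SubstPrf      : Formula 3
      SubstPrf-Δ₀   : Δ₀ SubstPrf
      SubstPrf-spec : ∀ g t p → Satℕ SubstPrf (g ∷ t ∷ p ∷ []) ⇔
        (∃[ n ] Σ (Formula n) λ φ → ⌜ φ ⌝ ≡ g × ∃[ τ ] ⌜ τ ⌝ ≡ t ×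
         IsProof (β ∪ ｛ φ ⟪ replicate n (numeral g) ⟫ ｝) p τ)

    -- Under the four quantifiers ∀x∀y∀p∀q the indices are q = 0, p = 1,
    -- y = 2, x = 3, and g = 4.
    Γ : Formula 1
    Γ = ∀' (∀' (∀' (∀' (¬'
          (Neg ⟪ var 3F ∷ var 2F ∷ [] ⟫
           ∧' SubstPrf ⟪ var 4F ∷ var 3F ∷ var 1F ∷ [] ⟫
           ∧' SubstPrf ⟪ var 4F ∷ var 2F ∷ var 0F ∷ [] ⟫)))))

    SelfCons : Sentence
    SelfCons = Γ ⟪ numeral ⌜ Γ ⌝ ∷ [] ⟫

    SelfJustifying : Axioms
    SelfJustifying = β ∪ ｛ SelfCons ｝

    -- Provability from β ∪ ｛ SelfCons ｝: SubstPrf with g the code of Γ.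
    Prf : ∀ {n} → Term n → Term n → Formula n
    Prf t p = SubstPrf ⟪ numeral ⌜ Γ ⌝ ⟪ [] ⟫ᵗ ∷ t ∷ p ∷ [] ⟫

  Π₁-Sentence : Set
  Π₁-Sentence = Σ Sentence (IsΠ 1)

  record Translation : Set where
    field
      translate  : Π₁-Sentence → Π₁-Sentence
      algorithm  : ∃[ f ] (∀ Ψ →
                   f ⟨ ⌜ proj₁ Ψ ⌝ ∷ [] ⟩⇓ ⌜ proj₁ (translate Ψ) ⌝)
      equivalent : ∀ Ψ → True (proj₁ Ψ) ⇔ True (proj₁ (translate Ψ))

  Reflection : ∀ {k β} → SelfReference k β → Translation → Π₁-Sentence → Sentence
  Reflection S T Ψ =
    ∀' (Prf (numeral ⌜ proj₁ Ψ ⌝ ⟪ [] ⟫ᵗ) (var 0F)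
        ⇒' proj₁ (translate Ψ) ⟪ [] ⟫)
    where open SelfReference S
          open Translation T

{-# OPTIONS --safe #-}

-- Ψᵀ says that the negation of Ψ is not provable from α.  Then α proves
-- reflection, because SelfCons at the numerals of Ψ and of its negation says
-- that a proof of Ψ excludes a proof of the negation.
--
-- The equivalence of Ψ and Ψᵀ needs that SelfCons is true.  Otherwise let
-- J = ♯{SelfCons}: the least violation consists of proofs p, q < 2^(J+1) of
-- some Ψ and of its negation.  A-stability makes Ψ Good(J/2) and E-stability
-- makes its negation Good(½⌊Log q⌋ − 1), so that the latter has a witness
-- below 2^(J/2), which the former excludes.  Once SelfCons is true,
-- ♯{SelfCons} = ∞, and E-stability says that α proves only true Σ₁ sentences.

module Submission where

open import Data.Fin using (Fin; zero; suc)
open import Data.Fin.Patterns using (0F; 1F; 2F; 3F; 4F)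
open import Data.Integer using (_⊖_; +_)
open import Data.Nat using (ℕ; zero; suc; _+_; _*_; _^_; _≤_; _<_; _≤?_; _≟_; z≤n; s≤s; s≤s⁻¹)
open import Data.Nat.Logarithm using (⌊log₂_⌋; ⌊log₂⌋-mono-≤; ⌊log₂[2^n]⌋≡n)
open import Data.Nat.Properties
open import Data.Product using (Σ; ∃-syntax; _×_; _,_; proj₁; proj₂; map₂)
import Data.Sum as Sum
open import Data.Sum using (inj₁; inj₂)
open import Data.Unit using (tt)
open import Data.Vec using (Vec; []; _∷_; lookup; map; replicate; tabulate)
open import Data.Vec.Relation.Binary.Pointwise.Inductive using ([]; _∷_)
open import Function using (_∘_; _⇔_; mk⇔; Equivalence)
open import Relation.Binary.PropositionalEquality using (_≡_; refl; sym; trans; cong; cong₂; subst)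
open import Relation.Nullary using (¬_; Dec; yes; no)
open import Relation.Nullary.Decidable using (¬?; _×-dec_; _⊎-dec_; _→-dec_; map′; decidable-stable)
open import Relation.Nullary.Construct.Add.Supremum using ([_]; ⊤⁺)
open import Relation.Unary using (_∪_; ｛_｝)
open import Defs

open Equivalence using (to; from)

-- Ceilings of square roots and of half-integer powers of two.

⌈√⌉-upper : ∀ m → m ≤ ⌈√ m ⌉ * ⌈√ m ⌉
⌈√⌉-upper zero = z≤n
⌈√⌉-upper (suc m) with suc m ≤? ⌈√ m ⌉ * ⌈√ m ⌉
... | yes m<r² = m<r²
... | no  _    = ≤-trans (s≤s (⌈√⌉-upper m)) (*-mono-< (n<1+n ⌈√ m ⌉) (n<1+n ⌈√ m ⌉))

⌈√⌉-least : ∀ m {k} → m ≤ k * k → ⌈√ m ⌉ ≤ k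
⌈√⌉-least zero _ = z≤n
⌈√⌉-least (suc m) {k} m<k² with suc m ≤? ⌈√ m ⌉ * ⌈√ m ⌉
... | yes _    = ⌈√⌉-least m (<⇒≤ m<k²)
... | no  m≮r² = ≰⇒> λ k≤r → m≮r² (≤-trans m<k² (*-mono-≤ k≤r k≤r))

⌈√⌉-mono-≤ : ∀ {m n} → m ≤ n → ⌈√ m ⌉ ≤ ⌈√ n ⌉
⌈√⌉-mono-≤ {m} {n} m≤n = ⌈√⌉-least m (≤-trans m≤n (⌈√⌉-upper n))

⌈√n²⌉≡n : ∀ n → ⌈√ n * n ⌉ ≡ n
⌈√n²⌉≡n n = ≤-antisym (⌈√⌉-least (n * n) ≤-refl)
  (≮⇒≥ λ r<n → <⇒≱ (*-mono-< r<n r<n) (⌈√⌉-upper (n * n)))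

⌈2^½2n⌉≡2^n : ∀ n → ⌈2^½ + (2 * n) ⌉ ≡ 2 ^ n
⌈2^½2n⌉≡2^n n = trans (cong ⌈√_⌉ 2^2n≡2^n*2^n) (⌈√n²⌉≡n (2 ^ n))
  where
  2^2n≡2^n*2^n : 2 ^ (2 * n) ≡ 2 ^ n * 2 ^ n
  2^2n≡2^n*2^n = trans (cong (λ k → 2 ^ (n + k)) (+-identityʳ n)) (^-distribˡ-+-* 2 n n)

-- Compares the two stability bounds. With `k` for ⌊Log q⌋ and `n` for ♯, the bound on the witness
-- from E-stability does not exceed the scope from A-stability.
⌈2^½⌉-⊖2-≤ : ∀ {k n} → k ≤ suc n → ⌈2^½ k ⊖ 2 ⌉ ≤ ⌈2^½ + n ⌉
-- For `k` equal to 0 or 1 the exponent is negative, and the default value 1 is also `⌈√ 1 ⌉`.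
⌈2^½⌉-⊖2-≤ {0}           {n} _ = ⌈√⌉-mono-≤ (m^n>0 2 n)
⌈2^½⌉-⊖2-≤ {1}           {n} _ = ⌈√⌉-mono-≤ (m^n>0 2 n)
⌈2^½⌉-⊖2-≤ {suc (suc k)} k<n   = ⌈√⌉-mono-≤ (^-monoʳ-≤ 2 (<⇒≤ (s≤s⁻¹ k<n)))

-- Constant recursive functions.

const : ∀ {n} → ℕ → Rec n
const zero    = zeroᴿ
const (suc k) = comp sucᴿ (const k ∷ [])

const⇓ : ∀ {n} k {xs : Vec ℕ n} → const k ⟨ xs ⟩⇓ k
const⇓ zero    = ⇓zero
const⇓ (suc k) = ⇓comp (const⇓ k ∷ []) ⇓suc

const⇓-unique : ∀ {n} k {xs : Vec ℕ n} {y} → const k ⟨ xs ⟩⇓ y → k ≡ y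
const⇓-unique zero    ⇓zero                     = refl
const⇓-unique (suc k) (⇓comp (k⇓y ∷ []) ⇓suc) = cong suc (const⇓-unique k k⇓y)

-- Substitution and satisfaction in an arbitrary structure.

module _ {S : Signature} where
  open Syntax S

  module _ (M : Structure) where
    open Structure M

    lookup-evals : ∀ {m n} (σ : Vec (Term m) n) {ρ} i →
                   eval (lookup σ i) ρ ≡ lookup (evals σ ρ) i
    lookup-evals (t ∷ σ) zero    = refl
    lookup-evals (t ∷ σ) (suc i) = lookup-evals σ i

    eval-⟪⟫ᵗ   : ∀ {m n} (t : Term n) {σ : Vec (Term m) n} {ρ} →
                 eval (t ⟪ σ ⟫ᵗ) ρ ≡ eval t (evals σ ρ)
    evals-⟪⟫ᵗˢ : ∀ {m n k} (ts : Vec (Term n) k) {σ : Vec (Term m) n} {ρ} →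
                 evals (ts ⟪ σ ⟫ᵗˢ) ρ ≡ evals ts (evals σ ρ)
    eval-⟪⟫ᵗ (var i)    {σ} = lookup-evals σ i
    eval-⟪⟫ᵗ (fun f ts)     = cong ⟦ f ⟧ (evals-⟪⟫ᵗˢ ts)
    evals-⟪⟫ᵗˢ []       = refl
    evals-⟪⟫ᵗˢ (t ∷ ts) = cong₂ _∷_ (eval-⟪⟫ᵗ t) (evals-⟪⟫ᵗˢ ts)

    -- An arbitrary renaming `f` makes the induction go through: the tail of the tabulated vector
    -- renames by `f ∘ suc`.
    evals-tabulate-var : ∀ {m n} (f : Fin n → Fin m) ρ (ρ′ : Vec Carrier n) →
                         (∀ i → lookup ρ (f i) ≡ lookup ρ′ i) →
                         evals (tabulate (var ∘ f)) ρ ≡ ρ′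
    evals-tabulate-var f ρ []       eq = refl
    evals-tabulate-var f ρ (a ∷ ρ′) eq =
      cong₂ _∷_ (eq zero) (evals-tabulate-var (f ∘ suc) ρ ρ′ (eq ∘ suc))

    eval-weakenᵗ : ∀ {n} (t : Term n) {a ρ} → eval (weakenᵗ t) (a ∷ ρ) ≡ eval t ρ
    eval-weakenᵗ t {a} {ρ} = trans (eval-⟪⟫ᵗ t)
      (cong (eval t) (evals-tabulate-var suc (a ∷ ρ) ρ (λ _ → refl)))

    evals-weakenᵗ : ∀ {m n} (σ : Vec (Term m) n) {a ρ} →
                    evals (map weakenᵗ σ) (a ∷ ρ) ≡ evals σ ρ
    evals-weakenᵗ []      = refl
    evals-weakenᵗ (t ∷ σ) = cong₂ _∷_ (eval-weakenᵗ t) (evals-weakenᵗ σ)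

    evals-lift : ∀ {m n} (σ : Vec (Term m) n) {a ρ ρ′} →
                 evals σ ρ ≡ ρ′ → evals (lift σ) (a ∷ ρ) ≡ a ∷ ρ′
    evals-lift σ eq = cong (_ ∷_) (trans (evals-weakenᵗ σ) eq)

    -- The environment `ρ′` is tied to `σ` only by an equation because, under a quantifier,
    -- `evals-lift` gives the extended environment only up to propositional equality.
    Sat-⟪⟫ : ∀ {m n} (φ : Formula n) (σ : Vec (Term m) n) {ρ ρ′} →
             evals σ ρ ≡ ρ′ → Sat (φ ⟪ σ ⟫) ρ ⇔ Sat φ ρ′
    Sat-lift : ∀ {m n} (φ : Formula (suc n)) (σ : Vec (Term m) n) {ρ a} →
               Sat (φ ⟪ lift σ ⟫) (a ∷ ρ) ⇔ Sat φ (a ∷ evals σ ρ)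
    Sat-lift φ σ = Sat-⟪⟫ φ (lift σ) (evals-lift σ refl)
    Sat-⟪⟫ (s ≈' t) σ {ρ} refl = mk⇔
      (λ eq → trans (sym (eval-⟪⟫ᵗ s)) (trans eq (eval-⟪⟫ᵗ t)))
      (λ eq → trans (eval-⟪⟫ᵗ s) (trans eq (sym (eval-⟪⟫ᵗ t))))
    Sat-⟪⟫ (s ≤' t) σ {ρ} refl
      rewrite eval-⟪⟫ᵗ s {σ} {ρ} | eval-⟪⟫ᵗ t {σ} {ρ} = mk⇔ (λ x → x) (λ x → x)
    Sat-⟪⟫ (¬' φ) σ refl = mk⇔ (_∘ from h) (_∘ to h)
      where h = Sat-⟪⟫ φ σ refl
    Sat-⟪⟫ (φ ∧' ψ) σ refl = mk⇔
      (λ (x , y) → to h x , to k y) (λ (x , y) → from h x , from k y)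
      where h = Sat-⟪⟫ φ σ refl
            k = Sat-⟪⟫ ψ σ refl
    Sat-⟪⟫ (φ ∨' ψ) σ refl = mk⇔ (Sum.map (to h) (to k)) (Sum.map (from h) (from k))
      where h = Sat-⟪⟫ φ σ refl
            k = Sat-⟪⟫ ψ σ refl
    Sat-⟪⟫ (φ ⇒' ψ) σ refl = mk⇔ (λ f → to k ∘ f ∘ from h) (λ f → from k ∘ f ∘ to h)
      where h = Sat-⟪⟫ φ σ refl
            k = Sat-⟪⟫ ψ σ refl
    Sat-⟪⟫ (∀' φ) σ refl = mk⇔
      (λ f a → to (Sat-lift φ σ) (f a)) (λ f a → from (Sat-lift φ σ) (f a))
    Sat-⟪⟫ (∃' φ) σ refl = mk⇔
      (map₂ (to (Sat-lift φ σ))) (map₂ (from (Sat-lift φ σ)))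
    Sat-⟪⟫ (∀≤ t φ) σ {ρ} refl rewrite eval-⟪⟫ᵗ t {σ} {ρ} = mk⇔
      (λ f a a≤t → to (Sat-lift φ σ) (f a a≤t)) (λ f a a≤t → from (Sat-lift φ σ) (f a a≤t))
    Sat-⟪⟫ (∃≤ t φ) σ {ρ} refl rewrite eval-⟪⟫ᵗ t {σ} {ρ} = mk⇔
      (map₂ (map₂ (to (Sat-lift φ σ)))) (map₂ (map₂ (from (Sat-lift φ σ))))

    Sat-⟪[]⟫ : ∀ {n} (φ : Sentence) {ρ : Vec Carrier n} → Sat (φ ⟪ [] ⟫) ρ ⇔ Sat φ []
    Sat-⟪[]⟫ φ = Sat-⟪⟫ φ [] refl

-- Bounded formulas, duals and scopes in `Standard-M`.

module _ (L : Language) where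
  open Language L

  Bounded⇒Dec : ∀ {n} {φ : Formula n} → Bounded φ → ∀ ρ → Dec (Satℕ φ ρ)
  Bounded⇒Dec (s ≈' t) ρ = evalℕ s ρ ≟ evalℕ t ρ
  Bounded⇒Dec (s ≤' t) ρ = evalℕ s ρ ≤? evalℕ t ρ
  Bounded⇒Dec (¬' b)   ρ = ¬? (Bounded⇒Dec b ρ)
  Bounded⇒Dec (b ∧' c) ρ = Bounded⇒Dec b ρ ×-dec Bounded⇒Dec c ρ
  Bounded⇒Dec (b ∨' c) ρ = Bounded⇒Dec b ρ ⊎-dec Bounded⇒Dec c ρ
  Bounded⇒Dec (b ⇒' c) ρ = Bounded⇒Dec b ρ →-dec Bounded⇒Dec c ρ
  Bounded⇒Dec (∀≤ t b) ρ = map′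
    (λ f a a≤t → f {a} (s≤s a≤t)) (λ f {a} a<1+t → f a (s≤s⁻¹ a<1+t))
    (allUpTo? (λ a → Bounded⇒Dec b (a ∷ ρ)) (suc (evalℕ t ρ)))
  Bounded⇒Dec (∃≤ t b) ρ = map′
    (λ (a , a<1+t , x) → a , s≤s⁻¹ a<1+t , x) (λ (a , a≤t , x) → a , s≤s a≤t , x)
    (anyUpTo? (λ a → Bounded⇒Dec b (a ∷ ρ)) (suc (evalℕ t ρ)))

  -- The catch-all clause of `Scope` reduces only once the head of the formula is known, hence the
  -- case split here and in `dual-bounded`.
  Scope-bounded : ∀ {n} {φ : Formula n} → Bounded φ → ∀ t → Scope t φ ≡ φ
  Scope-bounded (_ ≈' _) _ = refl
  Scope-bounded (_ ≤' _) _ = refl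
  Scope-bounded (¬' _)   _ = refl
  Scope-bounded (_ ∧' _) _ = refl
  Scope-bounded (_ ∨' _) _ = refl
  Scope-bounded (_ ⇒' _) _ = refl
  Scope-bounded (∀≤ _ _) _ = refl
  Scope-bounded (∃≤ _ _) _ = refl

  dual-bounded : ∀ {n} {φ : Formula n} → Bounded φ → dual φ ≡ ¬' φ
  dual-bounded (_ ≈' _) = refl
  dual-bounded (_ ≤' _) = refl
  dual-bounded (¬' _)   = refl
  dual-bounded (_ ∧' _) = refl
  dual-bounded (_ ∨' _) = refl
  dual-bounded (_ ⇒' _) = refl
  dual-bounded (∀≤ _ _) = refl
  dual-bounded (∃≤ _ _) = refl

  Satℕ-∀< : ∀ {n} (t : Term n) (φ : Formula (suc n)) {ρ N} → evalℕ t ρ ≡ N →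
            Satℕ (∀< t φ) ρ ⇔ (∀ a → a < N → Satℕ φ (a ∷ ρ))
  Satℕ-∀< t φ refl = mk⇔
    (λ f a a<t → f a (<⇒≤ a<t) (λ t≤a → <⇒≱ a<t (subst (_≤ a) (eval-weakenᵗ Standard-M t) t≤a)))
    (λ f a _ t≰a → f a (≰⇒> λ t≤a → t≰a (subst (_≤ a) (sym (eval-weakenᵗ Standard-M t)) t≤a)))

  Satℕ-∃< : ∀ {n} (t : Term n) (φ : Formula (suc n)) {ρ} →
            Satℕ (∃< t φ) ρ → ∃[ a ] a < evalℕ t ρ × Satℕ φ (a ∷ ρ)
  Satℕ-∃< t φ {ρ} (a , _ , t≰a , x) =
    a , ≰⇒> (λ t≤a → t≰a (subst (_≤ a) (sym (eval-weakenᵗ Standard-M t)) t≤a)) , x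

  module _ (Δ : Δ₀-Class L) where
    open Δ₀-Class Δ

    -- The matrix is decidable, and a double negation can be moved inside universal quantifiers.
    -- This replaces excluded middle when truth is inferred from irrefutability.
    IsΠ₁-stable : ∀ {n} {φ : Formula n} → IsΠ 1 φ → ∀ {ρ} → ¬ ¬ Satℕ φ ρ → Satℕ φ ρ
    IsΠ₁-stable (Σ→Π (Δ₀→Σ φ∈Δ₀)) {ρ} = decidable-stable (Bounded⇒Dec (bounded φ∈Δ₀) ρ)
    IsΠ₁-stable (∀' π) ¬¬x a = IsΠ₁-stable π λ ¬x → ¬¬x λ x → ¬x (x a)

    dual-IsΠ₁ : ∀ {n} {φ : Formula n} → IsΠ 1 φ → IsΣ 1 (dual φ)
    dual-IsΠ₁ (Σ→Π (Δ₀→Σ φ∈Δ₀)) rewrite dual-bounded (bounded φ∈Δ₀) = Π→Σ (Δ₀→Π (closed-¬ φ∈Δ₀))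
    dual-IsΠ₁ (∀' π) = ∃' (dual-IsΠ₁ π)

    Sat-Scope-dual : ∀ {n} {φ : Formula n} → IsΠ 1 φ → ∀ t {ρ} →
                     Satℕ φ ρ → ¬ Satℕ (Scope t (dual φ)) ρ
    Sat-Scope-dual (Σ→Π (Δ₀→Σ φ∈Δ₀)) t x
      rewrite dual-bounded (bounded φ∈Δ₀) = λ ¬x → ¬x x
    Sat-Scope-dual (∀' {φ = φ} π) t x y =
      let a , _ , y′ = Satℕ-∃< t (Scope (weakenᵗ t) (dual φ)) y
      in  Sat-Scope-dual π (weakenᵗ t) (x a) y′

    -- A witness below `t` is also below `s`, so the bounded universal quantifier applies to it.
    -- Peeling the prefix in this way ends at a matrix and its negation.
    Scope-Scope-dual : ∀ {n} {φ : Formula n} → IsΠ 1 φ → ∀ s t {ρ} →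
                       evalℕ t ρ ≤ evalℕ s ρ →
                       Satℕ (Scope s φ) ρ → ¬ Satℕ (Scope t (dual φ)) ρ
    Scope-Scope-dual (Σ→Π (Δ₀→Σ φ∈Δ₀)) s t _
      rewrite dual-bounded (bounded φ∈Δ₀) | Scope-bounded (bounded φ∈Δ₀) s = λ x ¬x → ¬x x
    Scope-Scope-dual (∀' {φ = φ} π) s t {ρ} t≤s x y =
      let a , a<t , y′ = Satℕ-∃< t (Scope (weakenᵗ t) (dual φ)) y
          x′ = to (Satℕ-∀< s (Scope (weakenᵗ s) φ) refl) x a (<-≤-trans a<t t≤s)
      in  Scope-Scope-dual π (weakenᵗ s) (weakenᵗ t) {a ∷ ρ}
            (subst (_≤ evalℕ (weakenᵗ s) (a ∷ ρ)) (sym (eval-weakenᵗ Standard-M t))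
              (subst (evalℕ t ρ ≤_) (sym (eval-weakenᵗ Standard-M s)) t≤s))
            x′ y′

-- The self-consistency sentence and its violations.

module _ (ξ : GenericConfiguration) (S : SelfReference ξ 1 (GenericConfiguration.B ξ)) where
  open GenericConfiguration ξ
  open SelfReference S

  -- Injectivity of the numbering identifies the formula with code `⌜ Γ ⌝` as `Γ` itself, and its
  -- diagonal instance is `SelfCons` by definition.
  SubstPrf-Γ : ∀ {τ q} → Satℕ SubstPrf (⌜ Γ ⌝ ∷ ⌜ τ ⌝ ∷ q ∷ []) ⇔ IsProof SelfJustifying q τ
  SubstPrf-Γ {τ} {q} = mk⇔ (proof ∘ to (SubstPrf-spec _ _ _))
    (λ π → from (SubstPrf-spec _ _ _) (1 , Γ , refl , τ , refl , π))
    where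
    proof : (∃[ n ] Σ (Formula n) λ φ → ⌜ φ ⌝ ≡ ⌜ Γ ⌝ × ∃[ τ′ ] ⌜ τ′ ⌝ ≡ ⌜ τ ⌝ ×
             IsProof (B ∪ ｛ φ ⟪ replicate n (numeral ⌜ Γ ⌝) ⟫ ｝) q τ′) →
            IsProof SelfJustifying q τ
    proof (_ , _ , eq , _ , eq′ , π) with ⌜⌝-injective eq | ⌜⌝-injective eq′
    ... | refl | refl = π

  Γ-matrix : Formula 5
  Γ-matrix = Neg ⟪ var 3F ∷ var 2F ∷ [] ⟫
    ∧' SubstPrf ⟪ var 4F ∷ var 3F ∷ var 1F ∷ [] ⟫
    ∧' SubstPrf ⟪ var 4F ∷ var 2F ∷ var 0F ∷ [] ⟫

  Γ-matrix-Δ₀ : Δ₀ Γ-matrix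
  Γ-matrix-Δ₀ = closed-∧ (closed-sub _ Neg-Δ₀)
    (closed-∧ (closed-sub _ SubstPrf-Δ₀) (closed-sub _ SubstPrf-Δ₀))

  -- The numeral for g after passing under the four quantifiers of `Γ`, in the form in which
  -- `SelfCons` unfolds.
  ⌜Γ⌝-subst : Vec (Term 4) 5
  ⌜Γ⌝-subst = lift (lift (lift (lift (numeral ⌜ Γ ⌝ ∷ []))))

  SelfCons-IsΠ₁ : IsΠ 1 SelfCons
  SelfCons-IsΠ₁ = ∀' (∀' (∀' (∀' (Σ→Π (Δ₀→Σ (closed-¬ (closed-sub ⌜Γ⌝-subst Γ-matrix-Δ₀)))))))

  module _ (M : Structure) where
    open Structure M

    -- The structure is arbitrary because completeness quantifies over all of them. There the
    -- numeral of `⌜ Γ ⌝` can have any value, which is recorded as `g`.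
    Violation : (g x y p q : Carrier) → Set
    Violation g x y p q = Sat Neg (x ∷ y ∷ []) ×
                          Sat SubstPrf (g ∷ x ∷ p ∷ []) ×
                          Sat SubstPrf (g ∷ y ∷ q ∷ [])

    Sat-SelfCons-matrix : ∀ {g x y p q} → eval (numeral ⌜ Γ ⌝) [] ≡ g →
                          Sat (Γ-matrix ⟪ ⌜Γ⌝-subst ⟫) (q ∷ p ∷ y ∷ x ∷ []) ⇔ Violation g x y p q
    Sat-SelfCons-matrix {g} {x} {y} {p} {q} eq = mk⇔
      (λ s → let a , b , c = to h s in to n a , to u b , to v c)
      (λ (a , b , c) → from h (from n a , from u b , from v c))
      where
      σ : Vec (Term 0) 1
      σ = numeral ⌜ Γ ⌝ ∷ []
      ρ = q ∷ p ∷ y ∷ x ∷ g ∷ []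
      h = Sat-⟪⟫ M Γ-matrix ⌜Γ⌝-subst {ρ′ = ρ}
            (evals-lift M (lift (lift (lift σ))) (evals-lift M (lift (lift σ))
              (evals-lift M (lift σ) (evals-lift M σ (cong (_∷ []) eq)))))
      n = Sat-⟪⟫ M Neg (var 3F ∷ var 2F ∷ []) {ρ} refl
      u = Sat-⟪⟫ M SubstPrf (var 4F ∷ var 3F ∷ var 1F ∷ []) {ρ} refl
      v = Sat-⟪⟫ M SubstPrf (var 4F ∷ var 2F ∷ var 0F ∷ []) {ρ} refl

    Sat-SelfCons : ∀ {g} → eval (numeral ⌜ Γ ⌝) [] ≡ g →
                   Sat SelfCons [] ⇔ (∀ x y p q → ¬ Violation g x y p q)
    Sat-SelfCons eq = mk⇔
      (λ s x y p q → s x y p q ∘ from (Sat-SelfCons-matrix eq))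
      (λ f x y p q → f x y p q ∘ to (Sat-SelfCons-matrix eq))

    Sat-Prf : ∀ {n} (t p : Term n) {ρ g a b} → eval (numeral ⌜ Γ ⌝) [] ≡ g →
              eval t ρ ≡ a → eval p ρ ≡ b →
              Sat (Prf t p) ρ ⇔ Sat SubstPrf (g ∷ a ∷ b ∷ [])
    Sat-Prf t p refl refl refl = Sat-⟪⟫ M SubstPrf (numeral ⌜ Γ ⌝ ⟪ [] ⟫ᵗ ∷ t ∷ p ∷ [])
      (cong (_∷ _) (eval-⟪⟫ᵗ M (numeral ⌜ Γ ⌝)))

  -- The translated sentence.

  Unprovable : Formula 1
  Unprovable = ∀' (¬' Prf (var 1F) (var 0F))

  -- All translations are numeral instances of a single formula, so `dual-recursive` and
  -- `inst-recursive` together compute their codes.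
  Unprovable-dual : Sentence → Sentence
  Unprovable-dual φ = Unprovable ⟪ numeral ⌜ dual φ ⌝ ∷ [] ⟫

  Unprovable-dual-IsΠ₁ : ∀ φ → IsΠ 1 (Unprovable-dual φ)
  Unprovable-dual-IsΠ₁ φ =
    ∀' (Σ→Π (Δ₀→Σ (closed-¬ (closed-sub _ (closed-sub _ SubstPrf-Δ₀)))))

  Unprovable-dual-recursive : ∃[ f ] (∀ φ → f ⟨ ⌜ φ ⌝ ∷ [] ⟩⇓ ⌜ Unprovable-dual φ ⌝)
  Unprovable-dual-recursive =
    let f , f⇓ = dual-recursive
        g , g⇓ = inst-recursive
    in  comp g (const ⌜ Unprovable ⌝ ∷ f ∷ []) ,
        λ φ → ⇓comp (const⇓ ⌜ Unprovable ⌝ ∷ f⇓ φ ∷ []) (g⇓ Unprovable ⌜ dual φ ⌝)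

  Sat-Unprovable-dual : ∀ M → let open Structure M in ∀ {g} φ {m} →
    eval (numeral ⌜ Γ ⌝) [] ≡ g → eval (numeral ⌜ dual φ ⌝) [] ≡ m →
    Sat (Unprovable-dual φ) [] ⇔ (∀ q → ¬ Sat SubstPrf (g ∷ m ∷ q ∷ []))
  Sat-Unprovable-dual M φ {m} eq eq′ = mk⇔
    (λ s q → to h s q ∘ from (Sat-Prf M _ _ eq refl refl))
    (λ f → from h λ q → f q ∘ to (Sat-Prf M _ _ eq refl refl))
    where h = Sat-⟪⟫ M Unprovable (numeral ⌜ dual φ ⌝ ∷ []) (cong (_∷ []) eq′)

  True-Unprovable-dual : ∀ φ → True (Unprovable-dual φ) ⇔ (¬ Provable SelfJustifying (dual φ))
  True-Unprovable-dual φ = mk⇔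
    (λ t (π , pr) → to h t ⌜ π ⌝ᵖ (from SubstPrf-Γ (π , refl , pr)))
    (λ ¬pr → from h λ q s → let π , _ , pr = to SubstPrf-Γ s in ¬pr (π , pr))
    where h = Sat-Unprovable-dual Standard-M φ (numeral-value _) (numeral-value _)

  -- Standard violations and the value of ♯ at `SelfCons`.

  Violation-proofs : ∀ {x y p q} → Violation Standard-M ⌜ Γ ⌝ x y p q →
    Σ Sentence λ Ψ → IsΠ 1 Ψ × IsProof SelfJustifying p Ψ × IsProof SelfJustifying q (dual Ψ)
  Violation-proofs (n , u , v) with to (Neg-spec _ _) n
  ... | Ψ , Ψ∈Π₁ , refl , refl = Ψ , Ψ∈Π₁ , to SubstPrf-Γ u , to SubstPrf-Γ v

  Good-SelfCons : ∀ J → Good ξ J SelfCons ⇔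
    (∀ x → x < 2 ^ J → ∀ y → y < 2 ^ J → ∀ p → p < 2 ^ J → ∀ q → q < 2 ^ J →
     ¬ Violation Standard-M ⌜ Γ ⌝ x y p q)
  Good-SelfCons J = mk⇔
    (λ s x x< y y< p p< q q< →
      to h₄ (to h₃ (to h₂ (to h₁ s x x<) y y<) p p<) q q< ∘ from matrix)
    (λ f → from h₁ λ x x< → from h₂ λ y y< → from h₃ λ p p< → from h₄ λ q q< →
      f x x< y y< p p< q q< ∘ to matrix)
    where
    t₁ : Term 0
    t₁ = numeral ⌈2^½ + (2 * J) ⌉
    t₂ = weakenᵗ t₁
    t₃ = weakenᵗ t₂
    t₄ = weakenᵗ t₃
    φ₄ = ¬' (Γ-matrix ⟪ ⌜Γ⌝-subst ⟫)
    φ₃ = ∀< t₄ φ₄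
    φ₂ = ∀< t₃ φ₃
    φ₁ = ∀< t₂ φ₂
    -- The ceiling is exact at the even exponent `2 * J`, and weakening under each quantifier keeps
    -- the value.
    e₁ : evalℕ t₁ [] ≡ 2 ^ J
    e₁ = trans (numeral-value _) (⌈2^½2n⌉≡2^n J)
    e₂ : ∀ {x} → evalℕ t₂ (x ∷ []) ≡ 2 ^ J
    e₂ = trans (eval-weakenᵗ Standard-M t₁) e₁
    e₃ : ∀ {x y} → evalℕ t₃ (y ∷ x ∷ []) ≡ 2 ^ J
    e₃ = trans (eval-weakenᵗ Standard-M t₂) e₂
    e₄ : ∀ {x y p} → evalℕ t₄ (p ∷ y ∷ x ∷ []) ≡ 2 ^ J
    e₄ = trans (eval-weakenᵗ Standard-M t₃) e₃
    h₁ = Satℕ-∀< L t₁ φ₁ e₁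
    h₂ : ∀ {x} → _
    h₂ {x} = Satℕ-∀< L t₂ φ₂ (e₂ {x})
    h₃ : ∀ {x y} → _
    h₃ {x} {y} = Satℕ-∀< L t₃ φ₃ (e₃ {x} {y})
    h₄ : ∀ {x y p} → _
    h₄ {x} {y} {p} = Satℕ-∀< L t₄ φ₄ (e₄ {x} {y} {p})
    matrix : ∀ {x y p q} → _
    matrix {x} {y} {p} {q} = Sat-SelfCons-matrix Standard-M {x = x} {y} {p} {q} (numeral-value _)

  ｛SelfCons｝-RE : RE-Class ξ ｛ SelfCons ｝
  ｛SelfCons｝-RE = (λ { refl → SelfCons-IsΠ₁ }) ,
    const ⌜ SelfCons ⌝ , λ x → mk⇔
      (λ { (_ , refl , refl) → 0 , const⇓ ⌜ SelfCons ⌝ })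
      (λ (_ , c⇓x) → SelfCons , refl , const⇓-unique ⌜ SelfCons ⌝ c⇓x)

  SelfJustifying-swap : ∀ {p φ} → IsProof SelfJustifying p φ → IsProof (｛ SelfCons ｝ ∪ B) p φ
  SelfJustifying-swap (π , eq , pr) = π , eq , monotone Sum.swap pr

  -- Goodness is inherited by smaller bounds, so goodness at some `J′` above `J` would give goodness
  -- at `suc J`.
  ♯≡[_] : ∀ J → Good ξ J SelfCons → ¬ Good ξ (suc J) SelfCons → _♯≡_ ξ ｛ SelfCons ｝ [ J ]
  ♯≡[ J ] good ¬good = (λ { refl → good }) , λ J′ good′ → ≮⇒≥ λ J<J′ →
    let 2^≤ = ^-monoʳ-≤ 2 J<J′
    in  ¬good (from (Good-SelfCons (suc J)) λ x x< y y< p p< q q< →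
          to (Good-SelfCons J′) (good′ refl) x (<-≤-trans x< 2^≤) y (<-≤-trans y< 2^≤)
            p (<-≤-trans p< 2^≤) q (<-≤-trans q< 2^≤))

  -- Truth of `SelfCons`, the translation and reflection.

  module _ (stable : EA-Stable ξ) where

    Good-SelfCons-all : ∀ J → Good ξ J SelfCons
    -- The only number below `2 ^ 0` is 0, and codes of proofs are positive.
    Good-SelfCons-all zero = from (Good-SelfCons 0) λ { _ _ _ _ zero _ _ _ v →
      let _ , _ , (π , eq , _) , _ = Violation-proofs v
      in  <⇒≢ (⌜⌝ᵖ-positive π) (sym eq) ; _ _ _ _ (suc _) (s≤s ()) }
    Good-SelfCons-all (suc J) =
      from (Good-SelfCons (suc J)) λ x x< y y< p p< q q< v →
      let Ψ , Ψ∈Π₁ , prp , prq = Violation-proofs v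
          -- The induction hypothesis bounds ♯ from below and the violation `v` bounds it from
          -- above.
          ♯J = ♯≡[ J ] (Good-SelfCons-all J)
                 (λ good → to (Good-SelfCons (suc J)) good x x< y y< p p< q q< v)
          Ψ-good  = proj₂ stable ｛SelfCons｝-RE ♯J Ψ∈Π₁ (SelfJustifying-swap prp) (<⇒≤ p<)
          ¬Ψ-good = proj₁ stable ｛SelfCons｝-RE ♯J (dual-IsΠ₁ L Δ Ψ∈Π₁) (SelfJustifying-swap prq) (<⇒≤ q<)
          -- From `q` below `2 ^ suc J`; the subtraction of 2 in E-stability then brings the
          -- exponent below `J`.
          log-q≤ = subst (⌊log₂ q ⌋ ≤_) (⌊log₂[2^n]⌋≡n (suc J)) (⌊log₂⌋-mono-≤ (<⇒≤ q<))
      in  Scope-Scope-dual L Δ Ψ∈Π₁ (numeral ⌈2^½ + J ⌉) (numeral ⌈2^½ ⌊log₂ q ⌋ ⊖ 2 ⌉)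
            (subst (_≤ evalℕ (numeral ⌈2^½ + J ⌉) []) (sym (numeral-value _))
              (subst (⌈2^½ ⌊log₂ q ⌋ ⊖ 2 ⌉ ≤_) (sym (numeral-value _)) (⌈2^½⌉-⊖2-≤ log-q≤)))
            Ψ-good ¬Ψ-good

    -- As ♯ is now infinite, a proof of any length meets the bound, whence the `tt`. A witness for
    -- the dual within the scope would contradict the truth of `φ`.
    True⇒¬Provable-dual : ∀ {φ} → IsΠ 1 φ → True φ → ¬ Provable SelfJustifying (dual φ)
    True⇒¬Provable-dual φ∈Π₁ φ-true (π , pr) =
      Sat-Scope-dual L Δ φ∈Π₁ (numeral ⌈2^½ ⌊log₂ ⌜ π ⌝ᵖ ⌋ ⊖ 2 ⌉) φ-true
        (proj₁ stable ｛SelfCons｝-RE {⊤⁺} (λ { J refl → Good-SelfCons-all J })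
          (dual-IsΠ₁ L Δ φ∈Π₁) (SelfJustifying-swap (π , refl , pr)) tt)

    ¬Provable-dual⇒True : ∀ {φ} → IsΠ 1 φ → ¬ Provable SelfJustifying (dual φ) → True φ
    ¬Provable-dual⇒True φ∈Π₁ ¬pr = IsΠ₁-stable L Δ φ∈Π₁ λ φ-false →
      let π , pr = B-refutes φ∈Π₁ φ-false in ¬pr (π , monotone inj₁ pr)

    T : Translation ξ
    T = record
      { translate  = λ (φ , _) → Unprovable-dual φ , Unprovable-dual-IsΠ₁ φ
      ; algorithm  = proj₁ Unprovable-dual-recursive ,
                     λ (φ , _) → proj₂ Unprovable-dual-recursive φ
      ; equivalent = λ (φ , φ∈Π₁) → mk⇔
          (from (True-Unprovable-dual φ) ∘ True⇒¬Provable-dual φ∈Π₁)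
          (¬Provable-dual⇒True φ∈Π₁ ∘ to (True-Unprovable-dual φ))
      }

    -- The specification of `Neg` holds only in `Standard-M`. Its instance at `Ψ` is therefore taken
    -- as the second premise of `indirect`: being a true Δ₀ sentence, it is provable from `B`.
    Provable-Reflection : ∀ Ψ → Provable SelfJustifying (Reflection ξ S T Ψ)
    Provable-Reflection (Ψ , Ψ∈Π₁) = indirect {X = SelfCons} {Y = Neg-Ψ}
      (complete λ _ axioms → axioms (inj₂ refl))
      (map₂ (monotone inj₁) (B-proves (Π→Σ (Δ₀→Π (closed-sub _ Neg-Δ₀))) Neg-Ψ-true))
      -- This implication holds in every structure: `p` and `q` would form a violation at whatever
      -- values the numerals have, hence the uses of `refl`.
      (complete λ M _ (selfCons , neg) p prf → from (Sat-⟪[]⟫ M (Unprovable-dual Ψ))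
        (from (Sat-Unprovable-dual M Ψ refl refl) λ q prf′ →
          to (Sat-SelfCons M refl) selfCons _ _ p q
            ( to (Sat-⟪⟫ M Neg σ refl) neg
            , to (Sat-Prf M (numeral ⌜ Ψ ⌝ ⟪ [] ⟫ᵗ) (var 0F) refl
                   (eval-⟪⟫ᵗ M (numeral ⌜ Ψ ⌝)) refl) prf
            , prf′)))
      where
      σ : Vec (Term 0) 2
      σ = numeral ⌜ Ψ ⌝ ∷ numeral ⌜ dual Ψ ⌝ ∷ []

      Neg-Ψ : Sentence
      Neg-Ψ = Neg ⟪ σ ⟫

      Neg-Ψ-true : True Neg-Ψ
      Neg-Ψ-true = from
        (Sat-⟪⟫ Standard-M Neg σ (cong₂ (λ x y → x ∷ y ∷ []) (numeral-value _) (numeral-value _)))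
        (from (Neg-spec _ _) (Ψ , Ψ∈Π₁ , refl , refl))

theorem6p12 : (ξ : GenericConfiguration) → let open GenericConfiguration ξ in
    EA-Stable ξ →
    (S : SelfReference ξ 1 B) → let open SelfReference S in
    Σ (Translation ξ) λ T → ((Ψ : Π₁-Sentence ξ) → Provable SelfJustifying (Reflection ξ S T Ψ))
theorem6p12 ξ stable S = T ξ S stable , Provable-Reflection ξ S stable
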